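{- Let $T$ be a distributive lattice and $n$ be a positive integer. The following properties are equivalent: (i) the order on $T$ is the intersection of $n$ scattered linear orders; (ii) $T$ is isomorphic to a sublattice of a (direct) product of $n$ scattered chains; (iii) $\dim(T)\leq n$ and $T$ is order-scattered.
   Context: A poset (or its order) is scattered, or order-scattered, if it contains no induced subposet isomorphic to the chain of rational numbers. A chain is a linearly ordered set; products are ordered componentwise. The dimension $\dim(T)$ is the least cardinality of a family of linear orders on $T$ whose intersection is the order of $T$. -}

module Defs where

open import Axiom.ExcludedMiddle using (ExcludedMiddle)
open import Axiom.Extensionality.Propositional using (Extensionality)
open import Algebra.Lattice.Bundles using (RawLattice)
open import Algebra.Lattice.Morphism.Structures using (IsLatticeMonomorphism)
import Algebra.Construct.NaturalChoice.Max as Max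
import Algebra.Construct.NaturalChoice.Min as Min
open import Data.Fin.Base using (Fin)
open import Data.Nat.Base using (ℕ; _≤_)
open import Data.Product.Base using (∃; ∃-syntax; Σ-syntax; _×_; _,_)
import Data.Rational.Base as ℚ
open import Data.Rational.Base using (ℚ)
open import Function.Bundles using (_⇔_)
open import Level using (Level; Setω; _⊔_; suc)
open import Relation.Binary.Bundles using (Poset; TotalOrder)
open import Relation.Binary.Core using (Rel)
open import Relation.Binary.Lattice.Bundles using (Lattice; DistributiveLattice)
open import Relation.Binary.Morphism.Structures using (IsOrderMonomorphism)
open import Relation.Binary.PropositionalEquality.Core using (_≡_)
open import Relation.Binary.Structures using (IsTotalOrder)
open import Relation.Nullary.Negation.Core using (¬_)

private
  variable
    c ℓ₁ ℓ₂ : Level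

-- Classical set-theoretic foundations.  Excluded middle is assumed for all
-- types, not only for propositions, so that it also yields an element of every
-- type that is not empty, i.e. a choice operator.  Function extensionality
-- makes that choice extensional on subsets given as Bool-valued functions, as
-- the set-theoretic axiom of choice requires.
record Classical : Setω where
  field
    excludedMiddle : ∀ {ℓ} → ExcludedMiddle ℓ
    extensionality : ∀ {a b} → Extensionality a b

-- An order monomorphism preserves and reflects the order, so its image is an
-- induced subposet isomorphic to its domain.
Scattered : Poset c ℓ₁ ℓ₂ → Set (c ⊔ ℓ₁ ⊔ ℓ₂)
Scattered P = ¬ (∃[ f ] IsOrderMonomorphism _≡_ P._≈_ ℚ._≤_ P._≤_ f)
  where module P = Poset P

record Realizer (P : Poset c ℓ₁ ℓ₂) (n : ℕ) : Set (c ⊔ ℓ₁ ⊔ suc ℓ₂) where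
  private module P = Poset P
  field
    order        : Fin n → Rel P.Carrier ℓ₂
    isTotalOrder : ∀ i → IsTotalOrder P._≈_ (order i)
    intersection : ∀ x y → x P.≤ y ⇔ (∀ i → order i x y)

  linearOrder : Fin n → TotalOrder c ℓ₁ ℓ₂
  linearOrder i = record { isTotalOrder = isTotalOrder i }

-- Minimality is only tested against finite families: an infinite family never
-- has smaller cardinality than d.
HasDimension : Poset c ℓ₁ ℓ₂ → ℕ → Set (c ⊔ ℓ₁ ⊔ suc ℓ₂)
HasDimension P d = Realizer P d × (∀ m → Realizer P m → d ≤ m)

Dimension≤ : Poset c ℓ₁ ℓ₂ → ℕ → Set (c ⊔ ℓ₁ ⊔ suc ℓ₂)
Dimension≤ P n = ∃[ d ] HasDimension P d × d ≤ n

-- The componentwise order; its joins and meets are the componentwise maxima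
-- and minima.
product : ∀ {n} → (Fin n → TotalOrder c ℓ₁ ℓ₂) → Lattice c ℓ₁ ℓ₂
product {n = n} C = record
  { Carrier   = ∀ i → C.Carrier i
  ; _≈_       = λ x y → ∀ i → C._≈_ i (x i) (y i)
  ; _≤_       = λ x y → ∀ i → C._≤_ i (x i) (y i)
  ; _∨_       = λ x y i → C.⊔._⊔_ i (x i) (y i)
  ; _∧_       = λ x y i → C.⊓._⊓_ i (x i) (y i)
  ; isLattice = record
    { isPartialOrder = record
      { isPreorder = record
        { isEquivalence = record
          { refl  = λ i → C.Eq.refl i
          ; sym   = λ p i → C.Eq.sym i (p i)
          ; trans = λ p q i → C.Eq.trans i (p i) (q i)
          }
        ; reflexive = λ p i → C.reflexive i (p i)
        ; trans     = λ p q i → C.trans i (p i) (q i)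
        }
      ; antisym = λ p q i → C.antisym i (p i) (q i)
      }
    ; supremum = λ x y →
        (λ i → C.⊔.x≤x⊔y i (x i) (y i)) ,
        (λ i → C.⊔.x≤y⊔x i (x i) (y i)) ,
        (λ _ p q i → C.⊔.⊔-lub i (p i) (q i))
    ; infimum = λ x y →
        (λ i → C.⊓.x⊓y≤x i (x i) (y i)) ,
        (λ i → C.⊓.x⊓y≤y i (x i) (y i)) ,
        (λ _ p q i → C.⊓.⊓-glb i (p i) (q i))
    }
  }
  where
  module C (i : Fin n) where
    open TotalOrder (C i) public
    module ⊔ = Max (C i)
    module ⊓ = Min (C i)

rawLattice : Lattice c ℓ₁ ℓ₂ → RawLattice c ℓ₁
rawLattice L = record { _≈_ = _≈_ ; _∧_ = _∧_ ; _∨_ = _∨_ }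
  where open Lattice L using (_≈_; _∧_; _∨_)

-- The image of a lattice monomorphism is a sublattice isomorphic to its domain.
_EmbedsIn_ : Lattice c ℓ₁ ℓ₂ → Lattice c ℓ₁ ℓ₂ → Set (c ⊔ ℓ₁)
L EmbedsIn M = ∃ (IsLatticeMonomorphism (rawLattice L) (rawLattice M))

module _ (T : DistributiveLattice c ℓ₁ ℓ₂) (n : ℕ) where
  open DistributiveLattice T using (poset; lattice)

  IntersectionOfScatteredLinearOrders : Set (c ⊔ ℓ₁ ⊔ suc ℓ₂)
  IntersectionOfScatteredLinearOrders =
    Σ[ R ∈ Realizer poset n ]
      (∀ i → Scattered (TotalOrder.poset (Realizer.linearOrder R i)))

  SublatticeOfProductOfScatteredChains : Set (suc (c ⊔ ℓ₁ ⊔ ℓ₂))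
  SublatticeOfProductOfScatteredChains =
    Σ[ C ∈ (Fin n → TotalOrder c ℓ₁ ℓ₂) ]
      (∀ i → Scattered (TotalOrder.poset (C i))) × lattice EmbedsIn product C

  Dimension≤×Scattered : Set (c ⊔ ℓ₁ ⊔ suc ℓ₂)
  Dimension≤×Scattered = Dimension≤ poset n × Scattered poset

{-# OPTIONS --safe #-}
-- Lexicographic orders on a product of n scattered chains, each with a different
-- leading coordinate, intersect in the product order; they are scattered since a
-- copy of ℚ is either embedded by the leading coordinate or has an interval
-- collapsed by it.  A copy of ℚ in T is one in each linear extension of T.
-- Conversely, each linear order ≼ of a realizer of T has a finest coarsening that
-- makes T a lattice homomorphic image onto a chain.  These quotients together
-- separate the points of T, and they are scattered since a countable chain in a
-- quotient of a lattice lifts to the lattice.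

module Submission where

open import Defs
import Algebra.Construct.NaturalChoice.Max as Max
import Algebra.Construct.NaturalChoice.Min as Min
open import Algebra.Lattice.Morphism.Structures using (IsLatticeMonomorphism)
open import Axiom.ExcludedMiddle using (ExcludedMiddle)
open import Data.Fin.Base using (Fin; zero; suc; splitAt; _↑ˡ_)
open import Data.Fin.Properties using (splitAt-↑ˡ)
open import Data.Integer.Base as ℤ using (ℤ; +_; -[1+_]; ∣_∣)
import Data.Integer.Properties as ℤ
open import Data.Integer.Tactic.RingSolver using (solve-∀)
open import Data.List.Base using (List; []; _∷_; foldr; map; filter)
open import Data.List.Membership.Propositional using (_∈_; lose)
open import Data.List.Membership.Propositional.Properties
  using (∈-map⁺; ∈-map⁻; ∈-filter⁺; ∈-filter⁻)
open import Data.List.Properties using (foldr-preservesᵇ; foldr-preservesᵒ)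
open import Data.List.Relation.Unary.All using (All; tabulate)
open import Data.List.Relation.Unary.Any using (here; there)
open import Data.Nat.Base as ℕ using (ℕ; zero; suc; NonZero; _≤_; _<_)
open import Data.Nat.Induction using (<-rec)
import Data.Nat.Properties as ℕ
open import Data.Product.Base using (∃; ∃-syntax; _×_; _,_; proj₁; proj₂; swap)
open import Data.Rational.Base as ℚ using (ℚ; mkℚ; 0ℚ; 1ℚ; fromℚᵘ)
import Data.Rational.Properties as ℚ
open import Data.Rational.Unnormalised.Base as ℚᵘ using (ℚᵘ; mkℚᵘ)
import Data.Rational.Unnormalised.Properties as ℚᵘ
open import Data.Sum.Base as Sum using (_⊎_; inj₁; inj₂; [_,_]′)
open import Data.Unit.Polymorphic.Base using (⊤; tt)
import Data.Vec.Functional as Vector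
open import Function.Base using (_∘_; const)
open import Function.Bundles using (_⇔_; mk⇔; Equivalence)
open import Level using (Level; _⊔_; Lift; lift)
open import Relation.Binary.Bundles using (Poset; TotalOrder)
open import Relation.Binary.Core using (Rel)
open import Relation.Binary.Definitions using (Transitive; Total; tri<; tri≈; tri>)
open import Relation.Binary.Lattice.Bundles using (Lattice; DistributiveLattice)
open import Relation.Binary.Morphism.Structures using (IsOrderMonomorphism)
open import Relation.Binary.PropositionalEquality as ≡
  using (_≡_; refl; sym; cong; subst; subst₂)
open import Relation.Binary.Structures using (IsTotalOrder)
open import Relation.Nullary.Decidable using (Dec; yes; no; True; toWitness; fromWitness)
open import Relation.Nullary.Negation using (¬_; contradiction)

private
  variable
    a ℓ ℓ₁ ℓ₂ : Level

-- Enumeration of ℚ.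

advance : ℕ × ℕ → ℕ × ℕ
advance (zero  , b) = suc b , zero
advance (suc a , b) = a , suc b

-- Cantor's walk: each antidiagonal is traversed from `(s , zero)` to `(zero , s)`, then `advance`
-- opens the next one.
unpair : ℕ → ℕ × ℕ
unpair zero    = zero , zero
unpair (suc n) = advance (unpair n)

unpair-surjective : ∀ a b → ∃[ n ] unpair n ≡ (a , b)
unpair-surjective a b = go (a ℕ.+ b) a b refl
  where
  -- Runs the walk backwards; `(s , b)` decreases lexicographically.
  go : ∀ s a b → a ℕ.+ b ≡ s → ∃[ n ] unpair n ≡ (a , b)
  go s       a       (suc b) eq with n , p ← go s (suc a) b (≡.trans (sym (ℕ.+-suc a b)) eq) =
    suc n , cong advance p
  go s       zero    zero    eq = zero , refl
  go (suc s) (suc a) zero    eq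
    with n , p ← go s zero a (≡.trans (sym (ℕ.+-identityʳ a)) (ℕ.suc-injective eq)) =
    suc n , cong advance p

-- Numerators are coded as differences, so rationals repeat. This is harmless: `Coherent` forces
-- entries for the same rational to lie below each other.
enumerate : ℕ → ℚ
enumerate n with k , d ← unpair n with a , b ← unpair k = (a ℤ.⊖ b) ℚ./ suc d

difference : ∀ i → ∃[ a ] ∃[ b ] a ℤ.⊖ b ≡ i
difference (+ m)    = m , 0 , refl
difference -[1+ m ] = 0 , suc m , refl

enumerate-surjective : ∀ q → ∃[ n ] enumerate n ≡ q
enumerate-surjective q@(mkℚ i d _)
  with a , b , a⊖b≡i ← difference i
  with k , unpair-k ← unpair-surjective a b
  with n , unpair-n ← unpair-surjective k d = n , enumerate-n
  where
  enumerate-n : enumerate n ≡ q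
  enumerate-n rewrite unpair-n | unpair-k | a⊖b≡i = ℚ.↥p/↧p≡p q

-- Embedding ℚ into a closed interval of ℚ.

i≤+∣i∣ : ∀ i → i ℤ.≤ + ∣ i ∣
i≤+∣i∣ (+ n)    = ℤ.≤-refl
i≤+∣i∣ -[1+ n ] = ℤ.-≤+

0≤+∣i∣+i : ∀ i → + 0 ℤ.≤ + ∣ i ∣ ℤ.+ i
0≤+∣i∣+i (+ n)    = ℤ.+≤+ ℕ.z≤n
0≤+∣i∣+i -[1+ n ] = ℤ.≤-reflexive (sym (ℤ.+-inverseʳ (+ suc n)))

-- Equality holds when i and j have the same sign; otherwise i < 0 ≤ j.
i*∣j∣≤j*∣i∣ : ∀ i j {d e} → i ℤ.* + suc e ℤ.< j ℤ.* + suc d →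
             i ℤ.* + ∣ j ∣ ℤ.≤ j ℤ.* + ∣ i ∣
i*∣j∣≤j*∣i∣ (+ m)    (+ n)    _ = ℤ.≤-reflexive (ℤ.*-comm (+ m) (+ n))
i*∣j∣≤j*∣i∣ -[1+ m ] -[1+ n ] _ = ℤ.≤-reflexive (lemma (+ suc m) (+ suc n))
  where
  lemma : ∀ a b → ℤ.- a ℤ.* b ≡ ℤ.- b ℤ.* a
  lemma = solve-∀
i*∣j∣≤j*∣i∣ -[1+ m ] (+ n)    _ = ℤ.≤-trans
  (subst (ℤ._≤ + 0)
    (≡.trans (cong ℤ.-_ (ℤ.pos-* (suc m) n)) (ℤ.neg-distribˡ-* (+ suc m) (+ n))) ℤ.neg-≤-pos)
  (subst (+ 0 ℤ.≤_) (ℤ.pos-* n (suc m)) (ℤ.+≤+ ℕ.z≤n))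
i*∣j∣≤j*∣i∣ (+ m)    -[1+ n ] {e = e} i<j =
  contradiction (subst (ℤ._< _) (sym (ℤ.pos-* m (suc e))) i<j) λ ()

weight : ℕ → ℤ → ℕ
weight d i = suc (d ℕ.+ ∣ i ∣)

-- ½ (1 + i / (b + |i|)) for the fraction i / b with b = suc d.
squash : ℚ → ℚᵘ
squash (mkℚ i d _) = mkℚᵘ (+ weight d i ℤ.+ i) (d ℕ.+ ∣ i ∣ ℕ.+ weight d i)

-- After cross-multiplication the common terms cancel, leaving twice `iM<jN`, which is the
-- hypothesis plus `i*∣j∣≤j*∣i∣`.
squash-mono-< : ∀ {p q} → p ℚ.< q → squash p ℚᵘ.< squash q
squash-mono-< {mkℚ i d _} {mkℚ j e _} (ℚ.*<* ie<jd) = ℚᵘ.*<* (begin-strict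
  (N ℤ.+ i) ℤ.* (M ℤ.+ M)
    ≡⟨ expand N M i ⟩
  N ℤ.* M ℤ.+ N ℤ.* M ℤ.+ (i ℤ.* M ℤ.+ i ℤ.* M)
    <⟨ ℤ.+-monoʳ-< (N ℤ.* M ℤ.+ N ℤ.* M) (ℤ.+-mono-< iM<jN iM<jN) ⟩
  N ℤ.* M ℤ.+ N ℤ.* M ℤ.+ (j ℤ.* N ℤ.+ j ℤ.* N)
    ≡⟨ contract N M j ⟩
  (M ℤ.+ j) ℤ.* (N ℤ.+ N) ∎)
  where
  open ℤ.≤-Reasoning
  N M : ℤ
  N = + weight d i
  M = + weight e j
  expand : ∀ n m i → (n ℤ.+ i) ℤ.* (m ℤ.+ m) ≡ n ℤ.* m ℤ.+ n ℤ.* m ℤ.+ (i ℤ.* m ℤ.+ i ℤ.* m)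
  expand = solve-∀
  contract : ∀ n m j → n ℤ.* m ℤ.+ n ℤ.* m ℤ.+ (j ℤ.* n ℤ.+ j ℤ.* n) ≡ (m ℤ.+ j) ℤ.* (n ℤ.+ n)
  contract = solve-∀
  iM<jN : i ℤ.* M ℤ.< j ℤ.* N
  iM<jN = subst₂ ℤ._<_
    (sym (ℤ.*-distribˡ-+ i (+ suc e) (+ ∣ j ∣))) (sym (ℤ.*-distribˡ-+ j (+ suc d) (+ ∣ i ∣)))
    (ℤ.+-mono-<-≤ ie<jd (i*∣j∣≤j*∣i∣ i j ie<jd))

0≤squash : ∀ p → ℚᵘ.0ℚᵘ ℚᵘ.≤ squash p
0≤squash (mkℚ i d _) = ℚᵘ.*≤* (begin
  + 0                           ≤⟨ 0≤+∣i∣+i i ⟩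
  + ∣ i ∣ ℤ.+ i                 ≤⟨ ℤ.+-monoˡ-≤ i (ℤ.+≤+ (ℕ.m≤n+m ∣ i ∣ (suc d))) ⟩
  + weight d i ℤ.+ i            ≡⟨ ℤ.*-identityʳ _ ⟨
  (+ weight d i ℤ.+ i) ℤ.* + 1  ∎)
  where open ℤ.≤-Reasoning

squash≤1 : ∀ p → squash p ℚᵘ.≤ ℚᵘ.1ℚᵘ
squash≤1 (mkℚ i d _) = ℚᵘ.*≤* (begin
  (+ weight d i ℤ.+ i) ℤ.* + 1             ≡⟨ ℤ.*-identityʳ _ ⟩
  + weight d i ℤ.+ i                       ≤⟨ ℤ.+-monoʳ-≤ (+ weight d i) i≤weight ⟩
  + weight d i ℤ.+ + weight d i            ≡⟨ ℤ.*-identityˡ _ ⟨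
  + 1 ℤ.* (+ weight d i ℤ.+ + weight d i)  ∎)
  where
  open ℤ.≤-Reasoning
  i≤weight : i ℤ.≤ + weight d i
  i≤weight = ℤ.≤-trans (i≤+∣i∣ i) (ℤ.+≤+ (ℕ.m≤n+m ∣ i ∣ (suc d)))

fromℚᵘ-mono-< : ∀ {p q} → p ℚᵘ.< q → fromℚᵘ p ℚ.< fromℚᵘ q
fromℚᵘ-mono-< {p} {q} p<q = ℚ.toℚᵘ-cancel-<
  (ℚᵘ.<-respˡ-≃ (ℚᵘ.≃-sym (ℚ.toℚᵘ-fromℚᵘ p)) (ℚᵘ.<-respʳ-≃ (ℚᵘ.≃-sym (ℚ.toℚᵘ-fromℚᵘ q)) p<q))

fromℚᵘ-mono-≤ : ∀ {p q} → p ℚᵘ.≤ q → fromℚᵘ p ℚ.≤ fromℚᵘ q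
fromℚᵘ-mono-≤ {p} {q} p≤q = ℚ.toℚᵘ-cancel-≤
  (ℚᵘ.≤-respˡ-≃ (ℚᵘ.≃-sym (ℚ.toℚᵘ-fromℚᵘ p)) (ℚᵘ.≤-respʳ-≃ (ℚᵘ.≃-sym (ℚ.toℚᵘ-fromℚᵘ q)) p≤q))

module Interval {p q : ℚ} (p<q : p ℚ.< q) where

  private
    instance
      q-p>0 : ℚ.Positive (q ℚ.- p)
      q-p>0 = ℚ.positive (subst (ℚ._< q ℚ.- p) (ℚ.+-inverseʳ p) (ℚ.+-monoˡ-< (ℚ.- p) p<q))

    scale : ℚ → ℚ
    scale t = p ℚ.+ (q ℚ.- p) ℚ.* t

    scale-mono-≤ : ∀ {s t} → s ℚ.≤ t → scale s ℚ.≤ scale t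
    scale-mono-≤ s≤t = ℚ.+-monoʳ-≤ p
      (ℚ.*-monoˡ-≤-nonNeg (q ℚ.- p) {{ℚ.pos⇒nonNeg (q ℚ.- p)}} s≤t)

    scale-0 : scale 0ℚ ≡ p
    scale-0 = ≡.trans (cong (p ℚ.+_) (ℚ.*-zeroʳ (q ℚ.- p))) (ℚ.+-identityʳ p)

    scale-1 : scale 1ℚ ≡ q
    scale-1 = ≡.trans (cong (p ℚ.+_) (≡.trans (ℚ.*-identityʳ (q ℚ.- p)) (ℚ.+-comm q (ℚ.- p))))
      (≡.trans (sym (ℚ.+-assoc p (ℚ.- p) q))
        (≡.trans (cong (ℚ._+ q) (ℚ.+-inverseʳ p)) (ℚ.+-identityˡ q)))

  intoInterval : ℚ → ℚ
  intoInterval x = scale (fromℚᵘ (squash x))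

  p≤intoInterval : ∀ x → p ℚ.≤ intoInterval x
  p≤intoInterval x =
    subst (ℚ._≤ intoInterval x) scale-0 (scale-mono-≤ (fromℚᵘ-mono-≤ (0≤squash x)))

  intoInterval≤q : ∀ x → intoInterval x ℚ.≤ q
  intoInterval≤q x =
    subst (intoInterval x ℚ.≤_) scale-1 (scale-mono-≤ (fromℚᵘ-mono-≤ (squash≤1 x)))

  intoInterval-mono-< : ∀ {x y} → x ℚ.< y → intoInterval x ℚ.< intoInterval y
  intoInterval-mono-< x<y = ℚ.+-monoʳ-< p
    (ℚ.*-monoʳ-<-pos (q ℚ.- p) (fromℚᵘ-mono-< (squash-mono-< x<y)))

-- Copies of ℚ in a relation.

-- Mentions no equality on `A`, so it applies to preorders such as the coordinates and the quotient
-- relations; in a poset, injectivity follows from `cancel`.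
record IsEmbedding {A : Set a} (R : Rel A ℓ) (g : ℚ → A) : Set ℓ where
  field
    mono   : ∀ {p q} → p ℚ.≤ q → R (g p) (g q)
    cancel : ∀ {p q} → R (g p) (g q) → p ℚ.≤ q

Contains-ℚ : {A : Set a} → Rel A ℓ → Set (a ⊔ ℓ)
Contains-ℚ R = ∃ (IsEmbedding R)

module _ (P : Poset a ℓ₁ ℓ₂) where
  private module P = Poset P

  scattered⁺ : ¬ Contains-ℚ P._≤_ → Scattered P
  scattered⁺ ∌ℚ (g , embedding) = ∌ℚ (g , record { IsOrderMonomorphism embedding })

  scattered⁻ : Scattered P → ¬ Contains-ℚ P._≤_
  scattered⁻ scattered (g , embedding) = scattered (g , record
    { isOrderHomomorphism = record { cong = λ { refl → P.Eq.refl } ; mono = mono }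
    ; injective = λ gp≈gq →
        ℚ.≤-antisym (cancel (P.reflexive gp≈gq)) (cancel (P.reflexive (P.Eq.sym gp≈gq)))
    ; cancel = cancel
    })
    where open IsEmbedding embedding

strict⇒embedding : {A : Set a} {R : Rel A ℓ} {g : ℚ → A} →
  (∀ {p q} → p ℚ.≤ q → R (g p) (g q)) → (∀ {p q} → p ℚ.< q → ¬ R (g q) (g p)) →
  IsEmbedding R g
strict⇒embedding mono strict = record
  { mono   = mono
  ; cancel = λ Rgpgq → ℚ.≮⇒≥ λ q<p → strict q<p Rgpgq
  }

embedIntoInterval : ∀ {p q} → p ℚ.< q →
  ∃[ φ ] IsEmbedding ℚ._≤_ φ × (∀ x → p ℚ.≤ φ x) × (∀ x → φ x ℚ.≤ q)
embedIntoInterval p<q = intoInterval ,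
  strict⇒embedding mono (λ x<y fy≤fx →
    ℚ.<-irrefl refl (ℚ.<-≤-trans (intoInterval-mono-< x<y) fy≤fx)) ,
  p≤intoInterval , intoInterval≤q
  where
  open Interval p<q
  mono : ∀ {x y} → x ℚ.≤ y → intoInterval x ℚ.≤ intoInterval y
  mono {x} {y} x≤y with ℚ.<-cmp x y
  ... | tri< x<y _ _  = ℚ.<⇒≤ (intoInterval-mono-< x<y)
  ... | tri≈ _ refl _ = ℚ.≤-refl
  ... | tri> _ _ y<x  = contradiction (ℚ.<-≤-trans y<x x≤y) (ℚ.<-irrefl refl)

-- Lexicographic orders.

module _ {A : Set a} where

  -- Lexicographic comparison for preorders: later relations are consulted only at a tie, where
  -- `R zero` holds both ways.
  Lex : ∀ {m} → (Fin m → Rel A ℓ) → Rel A ℓ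
  Lex {m = zero}  R x y = ⊤
  Lex {m = suc _} R x y = R zero x y × (R zero y x → Lex (R ∘ suc) x y)

  Lex-intro : ∀ {m} {R : Fin m → Rel A ℓ} {x y} → (∀ i → R i x y) → Lex R x y
  Lex-intro {m = zero}  Rxy = tt
  Lex-intro {m = suc _} Rxy = Rxy zero , λ _ → Lex-intro (Rxy ∘ suc)

  Lex-trans : ∀ {m} {R : Fin m → Rel A ℓ} → (∀ i → Transitive (R i)) → Transitive (Lex R)
  Lex-trans {m = zero}  tr _ _ = tt
  Lex-trans {m = suc _} tr (xy , xy′) (yz , yz′) =
    tr zero xy yz ,
    λ zx → Lex-trans (tr ∘ suc) (xy′ (tr zero yz zx)) (yz′ (tr zero zx xy))

  Lex-antisym : ∀ {m} {R : Fin m → Rel A ℓ} {x y} → Lex R x y → Lex R y x → ∀ i → R i x y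
  Lex-antisym (xy , _)   (yx , _)   zero    = xy
  Lex-antisym (xy , xy′) (yx , yx′) (suc i) = Lex-antisym (xy′ yx) (yx′ xy) i

  Lex-total : ExcludedMiddle ℓ → ∀ {m} {R : Fin m → Rel A ℓ} →
    (∀ i → Total (R i)) → Total (Lex R)
  Lex-total em {zero}      tot x y = inj₁ tt
  Lex-total em {suc m} {R} tot x y with em {R zero x y} | em {R zero y x}
  ... | yes xy | yes yx =
    Sum.map (λ l → xy , const l) (λ l → yx , const l) (Lex-total em (tot ∘ suc) x y)
  ... | yes xy | no ¬yx = inj₁ (xy , λ yx → contradiction yx ¬yx)
  ... | no ¬xy | yes yx = inj₂ (yx , λ xy → contradiction xy ¬xy)
  ... | no ¬xy | no ¬yx = contradiction (tot zero x y) [ ¬xy , ¬yx ]′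

  -- Either the leading relation is injective on the copy of ℚ, or it collapses
  -- an interval of it, which is then ordered by the remaining relations.
  Lex-scattered : (∀ {ℓ} → ExcludedMiddle ℓ) →
    ∀ {m} {R : Fin m → Rel A ℓ} → (∀ i → Transitive (R i)) →
    (∀ i → ¬ Contains-ℚ (R i)) → ¬ Contains-ℚ (Lex R)
  Lex-scattered em {m = zero} tr sc (g , embedding) =
    ℚ.<-irrefl refl (ℚ.<-≤-trans (ℚ.positive⁻¹ 1ℚ) (IsEmbedding.cancel embedding {1ℚ} {0ℚ} tt))
  Lex-scattered em {m = suc m} {R} tr sc (g , embedding)
    with em {P = ∃[ p ] ∃[ q ] p ℚ.< q × R zero (g q) (g p)}
  ... | no injective = sc zero (g , strict⇒embedding
          (proj₁ ∘ IsEmbedding.mono embedding) λ p<q Rqp → injective (_ , _ , p<q , Rqp))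
  ... | yes (p , q , p<q , Rqp) with φ , φ-embedding , p≤φ , φ≤q ← embedIntoInterval p<q =
    Lex-scattered em (tr ∘ suc) (sc ∘ suc) (g ∘ φ , record
      { mono   = λ {x} {y} x≤y → proj₂ (G.mono (Φ.mono x≤y)) (collapsed y x)
      ; cancel = λ {x} {y} gφx≤gφy → Φ.cancel (G.cancel (collapsed x y , const gφx≤gφy))
      })
    where
    module G = IsEmbedding embedding
    module Φ = IsEmbedding φ-embedding
    collapsed : ∀ x y → R zero (g (φ x)) (g (φ y))
    collapsed x y = tr zero (proj₁ (G.mono (φ≤q x))) (tr zero Rqp (proj₁ (G.mono (p≤φ y))))

-- The least number principle, which turns a realizer of size `n` into an exact dimension `d ≤ n`.
least : (∀ {ℓ} → ExcludedMiddle ℓ) → (Q : ℕ → Set ℓ) → ∀ n → Q n →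
        ∃[ d ] (Q d × (∀ m → Q m → d ≤ m)) × d ≤ n
least em Q = <-rec _ step
  where
  step : ∀ n → (∀ {k} → k < n → Q k → ∃[ d ] (Q d × (∀ m → Q m → d ≤ m)) × d ≤ k) →
         Q n → ∃[ d ] (Q d × (∀ m → Q m → d ≤ m)) × d ≤ n
  step n rec Qn with em {P = ∃[ k ] k < n × Q k}
  ... | no minimal = n , (Qn , λ m Qm → ℕ.≮⇒≥ λ m<n → minimal (m , m<n , Qm)) , ℕ.≤-refl
  ... | yes (k , k<n , Qk) with d , d-least , d≤k ← rec k<n Qk =
    d , d-least , ℕ.≤-trans d≤k (ℕ.<⇒≤ k<n)

-- Lifting a copy of ℚ along a lattice quotient.

module _ {c ℓ₁ ℓ₂} (L : Lattice c ℓ₁ ℓ₂) where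
  private module L = Lattice L
  open Lattice L using (Carrier; _∨_; _∧_) renaming (_≤_ to _⊑_)

  -- A copy of ℚ in the quotient of L by ≲ lifts to L.  Along an enumeration of ℚ, a
  -- representative of f q is joined with the chosen elements for p ≤ q and then
  -- met with those for r ≥ q; neither changes its class.
  module Lifting (_≲_ : Rel Carrier ℓ)
    (⊑⇒≲ : ∀ {x y} → x ⊑ y → x ≲ y) (≲-trans : Transitive _≲_)
    (≲-∨ : ∀ {x y z} → x ≲ z → y ≲ z → (x ∨ y) ≲ z)
    (≲-∧ : ∀ {x y z} → z ≲ x → z ≲ y → z ≲ (x ∧ y))
    (f : ℚ → Carrier) (f-embedding : IsEmbedding _≲_ f)
    where

    open IsEmbedding f-embedding renaming (mono to f-mono; cancel to f-cancel)

    Selection : Set c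
    Selection = List (ℚ × Carrier)

    record IsLift (q : ℚ) (x : Carrier) : Set ℓ where
      field
        below : x ≲ f q
        above : f q ≲ x

    record Coherent (ps : Selection) : Set (c ⊔ ℓ ⊔ ℓ₂) where
      field
        lifts : ∀ {q x} → (q , x) ∈ ps → IsLift q x
        mono : ∀ {p q x y} → (p , x) ∈ ps → (q , y) ∈ ps → p ℚ.≤ q → x ⊑ y

    module _ {P : ℚ → Set} (P? : ∀ q → Dec (P q)) where

      values : Selection → List Carrier
      values = map proj₂ ∘ filter (P? ∘ proj₁)

      ∈-values : ∀ {q x ps} → (q , x) ∈ ps → P q → x ∈ values ps
      ∈-values qx∈ps Pq = ∈-map⁺ proj₂ (∈-filter⁺ (P? ∘ proj₁) qx∈ps Pq)

      All-values : ∀ {k} {S : Carrier → Set k} {ps} →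
        (∀ {q x} → (q , x) ∈ ps → P q → S x) → All S (values ps)
      All-values {S = S} {ps} h = tabulate λ x∈ →
        let _ , qx∈ , x≡ = ∈-map⁻ proj₂ x∈
            qx∈ps , Pq   = ∈-filter⁻ (P? ∘ proj₁) {xs = ps} qx∈
        in subst S (sym x≡) (h qx∈ps Pq)

    joinBelow : ℚ → Selection → Carrier
    joinBelow q ps = foldr _∨_ (f q) (values (ℚ._≤? q) ps)

    clamp : ℚ → Selection → Carrier
    clamp q ps = foldr _∧_ (joinBelow q ps) (values (q ℚ.≤?_) ps)

    module _ (q : ℚ) {ps : Selection} (coherent : Coherent ps) where
      open Coherent coherent

      private
        u v : Carrier
        u = joinBelow q ps
        v = clamp q ps

        ⊑-foldr-∨ : ∀ {x} e xs → x ⊑ e ⊎ x ∈ xs → x ⊑ foldr _∨_ e xs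
        ⊑-foldr-∨ e xs h = foldr-preservesᵒ
          (λ y z → [ (λ x⊑y → L.trans x⊑y (L.x≤x∨y y z)) , (λ x⊑z → L.trans x⊑z (L.y≤x∨y y z)) ]′)
          e xs (Sum.map₂ (λ x∈ → lose x∈ L.refl) h)

        foldr-∧-⊑ : ∀ {x} e xs → e ⊑ x ⊎ x ∈ xs → foldr _∧_ e xs ⊑ x
        foldr-∧-⊑ e xs h = foldr-preservesᵒ
          (λ y z → [ (λ y⊑x → L.trans (L.x∧y≤x y z) y⊑x) , (λ z⊑x → L.trans (L.x∧y≤y y z) z⊑x) ]′)
          e xs (Sum.map₂ (λ x∈ → lose x∈ L.refl) h)

      -- `v` is a meet, and `x` lies below each factor: it is a joinand of `u`, and coherence
      -- compares it with every chosen `y` at `r ≥ q` because `p ≤ q ≤ r`.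
      clamp-mono : ∀ {p x} → (p , x) ∈ ps → p ℚ.≤ q → x ⊑ v
      clamp-mono px∈ p≤q = foldr-preservesᵇ L.∧-greatest
        (⊑-foldr-∨ (f q) (values (ℚ._≤? q) ps) (inj₂ (∈-values (ℚ._≤? q) px∈ p≤q)))
        (All-values (q ℚ.≤?_) λ ry∈ q≤r → mono px∈ ry∈ (ℚ.≤-trans p≤q q≤r))

      clamp-mono′ : ∀ {r y} → (r , y) ∈ ps → q ℚ.≤ r → v ⊑ y
      clamp-mono′ ry∈ q≤r = foldr-∧-⊑ u (values (q ℚ.≤?_) ps) (inj₂ (∈-values (q ℚ.≤?_) ry∈ q≤r))

      -- Elements chosen for `p ≤ q` are `≲ f p ≲ f q`, so the join stays `≲ f q`; those chosen for
      -- `r ≥ q` satisfy `f q ≲ f r ≲ y`, so the meet stays above `f q`.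
      clamp-lift : IsLift q v
      clamp-lift = record
        { below = ≲-trans (⊑⇒≲ (foldr-∧-⊑ u (values (q ℚ.≤?_) ps) (inj₁ L.refl)))
            (foldr-preservesᵇ ≲-∨ (f-mono ℚ.≤-refl)
              (All-values (ℚ._≤? q) λ px∈ p≤q → ≲-trans (IsLift.below (lifts px∈)) (f-mono p≤q)))
        ; above = foldr-preservesᵇ ≲-∧ (⊑⇒≲ (⊑-foldr-∨ (f q) (values (ℚ._≤? q) ps) (inj₁ L.refl)))
            (All-values (q ℚ.≤?_) λ ry∈ q≤r → ≲-trans (f-mono q≤r) (IsLift.above (lifts ry∈)))
        }

      extend : Coherent ((q , v) ∷ ps)
      extend = record
        { lifts = λ { (here refl) → clamp-lift ; (there x∈) → lifts x∈ }
        ; mono = λ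
          { (here refl) (here refl) _ → L.refl
          ; (here refl) (there y∈)    → clamp-mono′ y∈
          ; (there x∈)  (here refl)   → clamp-mono x∈
          ; (there x∈)  (there y∈)    → mono x∈ y∈
          }
        }

    selection : ℕ → Selection
    selection zero    = []
    selection (suc n) = (enumerate n , clamp (enumerate n) (selection n)) ∷ selection n

    selection-coherent : ∀ n → Coherent (selection n)
    selection-coherent zero    = record { lifts = λ () ; mono = λ () }
    selection-coherent (suc n) = extend (enumerate n) (selection-coherent n)

    selection-mono : ∀ {m n z} → m ℕ.≤′ n → z ∈ selection m → z ∈ selection n
    selection-mono ℕ.≤′-refl       z∈ = z∈
    selection-mono (ℕ.≤′-step m≤n) z∈ = there (selection-mono m≤n z∈)

    code : ℚ → ℕ
    code q = proj₁ (enumerate-surjective q)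

    -- Written with `enumerate (code q)` instead of `q`, so that it is literally the value at the
    -- head of the next selection.
    lifted : ℚ → Carrier
    lifted q = clamp (enumerate (code q)) (selection (code q))

    lifted-∈ : ∀ {q n} → code q ℕ.< n → (q , lifted q) ∈ selection n
    lifted-∈ {q} q<n = subst (λ p → (p , lifted q) ∈ _) (proj₂ (enumerate-surjective q))
      (selection-mono (ℕ.≤⇒≤′ q<n) (here refl))

    lifted-isLift : ∀ q → IsLift q (lifted q)
    lifted-isLift q = Coherent.lifts (selection-coherent (suc (code q))) (lifted-∈ {q} ℕ.≤-refl)

    lifted-mono : ∀ {p q} → p ℚ.≤ q → lifted p ⊑ lifted q
    lifted-mono {p} {q} = Coherent.mono (selection-coherent (suc (code p ℕ.⊔ code q)))
      (lifted-∈ {p} (ℕ.s≤s (ℕ.m≤m⊔n (code p) (code q))))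
      (lifted-∈ {q} (ℕ.s≤s (ℕ.m≤n⊔m (code p) (code q))))

    lifted-embedding : IsEmbedding _⊑_ lifted
    lifted-embedding = record
      { mono   = lifted-mono
      ; cancel = λ {p} {q} sp⊑sq → f-cancel (≲-trans (IsLift.above (lifted-isLift p))
          (≲-trans (⊑⇒≲ sp⊑sq) (IsLift.below (lifted-isLift q))))
      }

-- Chain quotients of a distributive lattice.

module _ {c ℓ₁ ℓ₂} (T : DistributiveLattice c ℓ₁ ℓ₂) where
  private module T = DistributiveLattice T
  open DistributiveLattice T using (Carrier; _∨_; _∧_) renaming (_≤_ to _⊑_)

  record IsTotalExtension {ℓ} (_≼_ : Rel Carrier ℓ) : Set (c ⊔ ℓ₂ ⊔ ℓ) where
    field
      extends : ∀ {x y} → x ⊑ y → x ≼ y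
      trans   : Transitive _≼_
      total   : Total _≼_

  -- Distributivity as the cut rule: `u` lies below `u ∧ (v ∨ a)`, which splits into `u ∧ v` and
  -- `u ∧ a`, both below `v`.
  cut : ∀ {u v} a → u ∧ a ⊑ v → u ⊑ v ∨ a → u ⊑ v
  cut {u} {v} a u∧a⊑v u⊑v∨a = T.trans (T.∧-greatest T.refl u⊑v∨a)
    (T.trans (T.reflexive (T.∧-distribˡ-∨ u v a)) (T.∨-least (T.x∧y≤y u v) u∧a⊑v))

  -- By cut, u ⊑ v may be proved by deciding any a: either u ⊑ a or a ⊑ v may be
  -- assumed after replacing u by u ∧ a or v by v ∨ a.  Locally P u v says that P
  -- holds after finitely many such replacements.
  Locally : Rel Carrier ℓ → Rel Carrier (c ⊔ ℓ₂ ⊔ ℓ)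
  Locally P u v = (∀ {u′ v′} → u′ ⊑ u → v ⊑ v′ → P u′ v′ → u′ ⊑ v′) → u ⊑ v

  -- The relations are settled one at a time; monotonicity keeps those already settled true under
  -- later replacements.
  Locally-∀ : ∀ {x y n} {P : Fin n → Rel Carrier ℓ} →
    (∀ i {u v u′ v′} → u′ ⊑ u → v ⊑ v′ → P i u v → P i u′ v′) →
    (∀ i {u v} → u ⊑ x → y ⊑ v → Locally (P i) u v) →
    ∀ {u v} → u ⊑ x → y ⊑ v → Locally (λ u v → ∀ i → P i u v) u v
  Locally-∀ {n = zero}  mono local u⊑x y⊑v k = k T.refl T.refl λ ()
  Locally-∀ {n = suc n} mono local u⊑x y⊑v k =
    local zero u⊑x y⊑v λ u′⊑u v⊑v′ p →
    Locally-∀ (mono ∘ suc) (local ∘ suc) (T.trans u′⊑u u⊑x) (T.trans y⊑v v⊑v′) λ u″⊑u′ v′⊑v″ ps →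
    k (T.trans u″⊑u′ u′⊑u) (T.trans v⊑v′ v′⊑v″) λ
      { zero    → mono zero u″⊑u′ v′⊑v″ p
      ; (suc i) → ps i
      }

  -- A prime filter F is an upset of one of the linear orders of a realizer: for
  -- u ∈ F and v ∉ F the nonempty set of orders placing v below u shrinks as u
  -- decreases and v increases, so some order lies in all these sets.  The prime
  -- filters that are upsets of a given order ≼ form a chain, hence define a chain
  -- quotient of T.  Below y is the least complement of such a filter that contains
  -- y, so it gives that quotient without constructing any prime filter.
  module ChainQuotient {_≼_ : Rel Carrier ℓ} (isTotalExtension : IsTotalExtension _≼_) where
    open IsTotalExtension isTotalExtension

    data Below (y : Carrier) : Carrier → Set (c ⊔ ℓ) where
      self  : Below y y
      down  : ∀ {z w} → z ≼ w → Below y w → Below y z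
      join  : ∀ {a b} → Below y a → Below y b → Below y (a ∨ b)
      -- The complement of a prime filter contains `a` or `b` once it contains `a ∧ b`; being a
      -- `≼`-downset, it contains `a` in either case.
      prime : ∀ {a b} → a ≼ b → Below y (a ∧ b) → Below y a

    Below-trans : ∀ {x y z} → Below y x → Below z y → Below z x
    Below-trans self            y≲z = y≲z
    Below-trans (down x≼w w≲y)  y≲z = down x≼w (Below-trans w≲y y≲z)
    Below-trans (join a≲y b≲y)  y≲z = join (Below-trans a≲y y≲z) (Below-trans b≲y y≲z)
    Below-trans (prime a≼b m≲y) y≲z = prime a≼b (Below-trans m≲y y≲z)

    ⊑⇒Below : ∀ {x y} → x ⊑ y → Below y x
    ⊑⇒Below x⊑y = down (extends x⊑y) self

    Below-total : ∀ x y → Below y x ⊎ Below x y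
    Below-total x y = Sum.map (λ x≼y → down x≼y self) (λ y≼x → down y≼x self) (total x y)

    -- By `prime`, the `≼`-smaller of `x` and `y` is identified with `x ∧ y`.
    Below-∧ : ∀ {x y z} → Below x z → Below y z → Below (x ∧ y) z
    Below-∧ {x} {y} z≲x z≲y with total x y
    ... | inj₁ x≼y = Below-trans z≲x (prime x≼y self)
    ... | inj₂ y≼x = Below-trans z≲y
      (prime y≼x (⊑⇒Below (T.∧-greatest (T.x∧y≤y y x) (T.x∧y≤x y x))))

    -- Induction on the derivation of `Below y x`. For a prime filter that contains `u` and avoids
    -- `v`: unless the order eventually puts `u` below `v`, the filter is an upset of it and so
    -- omits `x` along with `y`.
    Locally-decided : ∀ {x y} → Below y x → ∀ {u v} → y ⊑ v → Locally (λ u v → x ⊑ v ⊎ u ≼ v) u v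
    Locally-decided self y⊑v k = k T.refl T.refl (inj₁ y⊑v)
    Locally-decided (down {x} {w} x≼w w≲y) y⊑v k = Locally-decided w≲y y⊑v λ
      { {u} {v} u⊑ ⊑v (inj₂ u≼v) → k u⊑ ⊑v (inj₂ u≼v)
      -- Decide `x`: either `u ∧ x ≼ x ≼ w ≼ v`, or `v ∨ x` absorbs `x`.
      ; {u} {v} u⊑ ⊑v (inj₁ w⊑v) → cut x
          (k (T.trans (T.x∧y≤x u x) u⊑) ⊑v
            (inj₂ (trans (extends (T.x∧y≤y u x)) (trans x≼w (extends w⊑v)))))
          (k u⊑ (T.trans ⊑v (T.x≤x∨y v x)) (inj₁ (T.y≤x∨y v x)))
      }
    Locally-decided (join {a} {b} a≲y b≲y) y⊑v k = Locally-decided a≲y y⊑v λ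
      { u⊑ ⊑v (inj₂ u≼v) → k u⊑ ⊑v (inj₂ u≼v)
      ; u⊑ ⊑v (inj₁ a⊑v) → Locally-decided b≲y (T.trans y⊑v ⊑v) λ
        { u′⊑ ⊑v′ (inj₂ u≼v) → k (T.trans u′⊑ u⊑) (T.trans ⊑v ⊑v′) (inj₂ u≼v)
        ; u′⊑ ⊑v′ (inj₁ b⊑v) → k (T.trans u′⊑ u⊑) (T.trans ⊑v ⊑v′)
            (inj₁ (T.∨-least (T.trans a⊑v ⊑v′) b⊑v))
        }
      }
    Locally-decided (prime {a} {b} a≼b m≲y) y⊑v k = Locally-decided m≲y y⊑v λ
      { {u} {v} u⊑ ⊑v (inj₂ u≼v) → k u⊑ ⊑v (inj₂ u≼v)
      -- Decide `a`, then `b`. With both met into `u`, `m⊑v` finishes; with `a` in `u` and `b` in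
      -- `v`, `u ∧ a ≼ a ≼ b ≼ v ∨ b`; otherwise `v ∨ a` absorbs `a`.
      ; {u} {v} u⊑ ⊑v (inj₁ m⊑v) → cut a
          (cut b
            (T.trans
              (T.∧-greatest (T.trans (T.x∧y≤x (u ∧ a) b) (T.x∧y≤y u a)) (T.x∧y≤y (u ∧ a) b))
              m⊑v)
            (k (T.trans (T.x∧y≤x u a) u⊑) (T.trans ⊑v (T.x≤x∨y v b))
              (inj₂ (trans (extends (T.x∧y≤y u a)) (trans a≼b (extends (T.y≤x∨y v b)))))))
          (k u⊑ (T.trans ⊑v (T.x≤x∨y v a)) (inj₁ (T.y≤x∨y v a)))
      }

    -- In the outcome `x ⊑ v`, the bound `u ⊑ x` closes the goal at once; only `u ≼ v` remains.
    Locally-≼ : ∀ {x y} → Below y x → ∀ {u v} → u ⊑ x → y ⊑ v → Locally _≼_ u v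
    Locally-≼ x≲y u⊑x y⊑v k = Locally-decided x≲y y⊑v λ u′⊑u v⊑v′ →
      [ (λ x⊑v′ → T.trans u′⊑u (T.trans u⊑x x⊑v′)) , k u′⊑u v⊑v′ ]′

  module _ {n} {_≼[_]_ : Carrier → Fin n → Carrier → Set ℓ}
    (isTotalExtension : ∀ i → IsTotalExtension (_≼[ i ]_))
    (reflects : ∀ {x y} → (∀ i → x ≼[ i ] y) → x ⊑ y) where
    private module Q (i : Fin n) = ChainQuotient (isTotalExtension i)

    -- Each order in turn is brought to put `u` below `v`; once all do, `reflects` gives `u ⊑ v`.
    Below-reflects : ∀ {x y} → (∀ i → Q.Below i y x) → x ⊑ y
    Below-reflects x≲y = Locally-∀ mono (λ i → Q.Locally-≼ i (x≲y i)) T.refl T.refl λ _ _ → reflects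
      where
      mono : ∀ i {u v u′ v′} → u′ ⊑ u → v ⊑ v′ → u ≼[ i ] v → u′ ≼[ i ] v′
      mono i u′⊑u v⊑v′ u≼v = E.trans (E.extends u′⊑u) (E.trans u≼v (E.extends v⊑v′))
        where module E = IsTotalExtension (isTotalExtension i)

-- The quotients as scattered chains.

module _ (em : ∀ {ℓ} → ExcludedMiddle ℓ) where

  -- Chains must have their equality in Set ℓ₁ and their order in Set ℓ₂.
  Resize : ∀ {ℓ} k → Set ℓ → Set k
  Resize k P = Lift k (True (em {P = P}))

  resize : ∀ {ℓ k} {P : Set ℓ} → P → Resize k P
  resize p = lift (fromWitness p)

  unresize : ∀ {ℓ k} {P : Set ℓ} → Resize k P → P
  unresize (lift t) = toWitness t

  module _ {c ℓ₁ ℓ₂} (T : DistributiveLattice c ℓ₁ ℓ₂) where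
    private module T = DistributiveLattice T

    module _ {_≼_ : Rel T.Carrier ℓ} (isTotalExtension : IsTotalExtension T _≼_) where
      open ChainQuotient T isTotalExtension

      chainQuotient : TotalOrder c ℓ₁ ℓ₂
      chainQuotient = record
        { Carrier = T.Carrier
        ; _≈_ = λ x y → Resize ℓ₁ (Below y x × Below x y)
        ; _≤_ = λ x y → Resize ℓ₂ (Below y x)
        ; isTotalOrder = record
          { isPartialOrder = record
            { isPreorder = record
              { isEquivalence = record
                { refl  = resize (self , self)
                ; sym   = resize ∘ swap ∘ unresize
                ; trans = λ x≈y y≈z →
                    let x≲y , y≲x = unresize x≈y ; y≲z , z≲y = unresize y≈z
                    in resize (Below-trans x≲y y≲z , Below-trans z≲y y≲x)
                }
              ; reflexive = resize ∘ proj₁ ∘ unresize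
              ; trans     = λ x≲y y≲z → resize (Below-trans (unresize x≲y) (unresize y≲z))
              }
            ; antisym = λ x≲y y≲x → resize (unresize x≲y , unresize y≲x)
            }
          ; total = λ x y → Sum.map resize resize (Below-total x y)
          }
        }

      chainQuotient-scattered : Scattered T.poset → Scattered (TotalOrder.poset chainQuotient)
      chainQuotient-scattered scattered =
        scattered⁺ (TotalOrder.poset chainQuotient) λ (f , f-embedding) →
        scattered⁻ T.poset scattered (_ , Lifting.lifted-embedding T.lattice
          (TotalOrder._≤_ chainQuotient)
          (resize ∘ ⊑⇒Below) (TotalOrder.trans chainQuotient)
          (λ x≲z y≲z → resize (join (unresize x≲z) (unresize y≲z)))
          (λ z≲x z≲y → resize (Below-∧ (unresize z≲x) (unresize z≲y)))
          f f-embedding)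

    -- Every coordinate is the identity on carriers; `∨` and `∧` are preserved because they remain
    -- suprema and infima for `Below`.
    embedsInProductOfQuotients : ∀ {n} {_≼[_]_ : T.Carrier → Fin n → T.Carrier → Set ℓ}
      (isTotalExtension : ∀ i → IsTotalExtension T (_≼[ i ]_)) →
      (∀ {x y} → (∀ i → x ≼[ i ] y) → x T.≤ y) →
      T.lattice EmbedsIn product (λ i → chainQuotient (isTotalExtension i))
    embedsInProductOfQuotients {n = n} isTotalExtension reflects = (λ x i → x) , record
      { isLatticeHomomorphism = record
        { isRelHomomorphism = record
          { cong = λ x≈y i → resize
              (Q.⊑⇒Below i (T.reflexive x≈y) , Q.⊑⇒Below i (T.reflexive (T.Eq.sym x≈y))) }
        ; ∧-homo = λ x y i → C.antisym i
            (C.⊓.⊓-glb i (resize (Q.⊑⇒Below i (T.x∧y≤x x y))) (resize (Q.⊑⇒Below i (T.x∧y≤y x y))))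
            (resize (Q.Below-∧ i (unresize (C.⊓.x⊓y≤x i x y)) (unresize (C.⊓.x⊓y≤y i x y))))
        ; ∨-homo = λ x y i → C.antisym i
            (resize (Q.join (unresize (C.⊔.x≤x⊔y i x y)) (unresize (C.⊔.x≤y⊔x i x y))))
            (C.⊔.⊔-lub i (resize (Q.⊑⇒Below i (T.x≤x∨y x y))) (resize (Q.⊑⇒Below i (T.y≤x∨y x y))))
        }
      ; injective = λ x≈y → T.antisym
          (Below-reflects T isTotalExtension reflects (proj₁ ∘ unresize ∘ x≈y))
          (Below-reflects T isTotalExtension reflects (proj₂ ∘ unresize ∘ x≈y))
      }
      where
      module Q (i : Fin n) = ChainQuotient T (isTotalExtension i)
      module C (i : Fin n) where
        open TotalOrder (chainQuotient (isTotalExtension i)) public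
        module ⊔ = Max (chainQuotient (isTotalExtension i))
        module ⊓ = Min (chainQuotient (isTotalExtension i))

    dimension⇒sublattice : ∀ n → Dimension≤×Scattered T n → SublatticeOfProductOfScatteredChains T n
    dimension⇒sublattice _ ((d , (R , _) , d≤n) , scattered)
      with k , refl ← ℕ.m≤n⇒∃[o]m+o≡n d≤n =
      (λ i → chainQuotient (padded-extends i)) ,
      (λ i → chainQuotient-scattered (padded-extends i) scattered) ,
      embedsInProductOfQuotients padded-extends λ {x} {y} x≼y →
        Equivalence.from (R.intersection x y) λ j →
          subst (λ s → fromSum s x y) (splitAt-↑ˡ d j k) (x≼y (j ↑ˡ k))
      where
      module R = Realizer R
      -- Surplus indices are given the relation that collapses T to a point.
      fromSum : ∀ {k} → Fin d ⊎ Fin k → Rel T.Carrier ℓ₂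
      fromSum (inj₁ j) = R.order j
      fromSum (inj₂ _) _ _ = ⊤
      padded-extends : ∀ {k} (i : Fin (d ℕ.+ k)) → IsTotalExtension T (fromSum (splitAt d i))
      padded-extends i with splitAt d i
      ... | inj₁ j = record
        { extends = λ {x} {y} x⊑y → Equivalence.to (R.intersection x y) x⊑y j
        ; trans   = O.trans
        ; total   = O.total
        } where module O = IsTotalOrder (R.isTotalOrder j)
      ... | inj₂ _ = record { extends = const tt ; trans = λ _ _ → tt ; total = λ _ _ → inj₁ tt }

    -- Scattered realizers from products of chains, and the dimension bound.

    module _ {n} (C : Fin n → TotalOrder c ℓ₁ ℓ₂)
      (C-scattered : ∀ i → Scattered (TotalOrder.poset (C i)))
      (g : T.Carrier → ∀ i → TotalOrder.Carrier (C i))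
      (g-mono : IsLatticeMonomorphism (rawLattice T.lattice) (rawLattice (product C)) g) where
      private
        module G = IsLatticeMonomorphism g-mono
        module C (i : Fin n) where
          open TotalOrder (C i) public
          open Min (C i) public

      coordinate : Fin n → Rel T.Carrier ℓ₂
      coordinate i x y = C._≤_ i (g x i) (g y i)

      coordinate-trans : ∀ i → Transitive (coordinate i)
      coordinate-trans i = C.trans i

      coordinate-scattered : ∀ i → ¬ Contains-ℚ (coordinate i)
      coordinate-scattered i (h , embedding) =
        scattered⁻ (C.poset i) (C-scattered i)
          ((λ q → g (h q) i) , record { IsEmbedding embedding })

      -- A lattice monomorphism speaks only of equality and the operations, so the order is read off
      -- from `x ∧ y ≈ x`.
      ⊑⇒coordinate : ∀ {x y} → x T.≤ y → ∀ i → coordinate i x y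
      ⊑⇒coordinate {x} {y} x⊑y i = C.x⊓y≈x⇒x≤y i (C.Eq.trans i (C.Eq.sym i (G.∧-homo x y i))
        (G.⟦⟧-cong (T.antisym (T.x∧y≤x x y) (T.∧-greatest T.refl x⊑y)) i))

      coordinate⇒⊑ : ∀ {x y} → (∀ i → coordinate i x y) → x T.≤ y
      coordinate⇒⊑ {x} {y} x≤y = T.trans
        (T.reflexive (T.Eq.sym (G.injective λ i →
          C.Eq.trans i (G.∧-homo x y i) (C.x≤y⇒x⊓y≈x i (x≤y i)))))
        (T.x∧y≤y x y)

      -- Coordinate `i` leads and all coordinates follow, `i` included: this avoids deleting an
      -- index, and `i` is already tied at its second turn.
      lexicographic : Fin n → Rel T.Carrier ℓ₂
      lexicographic i = Lex (coordinate i Vector.∷ coordinate)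

      private
        prepended : {P : Rel T.Carrier ℓ₂ → Set ℓ} → (∀ i → P (coordinate i)) →
          ∀ i j → P ((coordinate i Vector.∷ coordinate) j)
        prepended p i zero    = p i
        prepended p i (suc j) = p j

      lexicographicRealizer : Realizer T.poset n
      lexicographicRealizer = record
        { order = lexicographic
        ; isTotalOrder = λ i → record
          { isPartialOrder = record
            { isPreorder = record
              { isEquivalence = T.isEquivalence
              ; reflexive = λ x≈y → ⊑⇒lexicographic (T.reflexive x≈y) i
              ; trans = Lex-trans (prepended {P = λ R → Transitive R} coordinate-trans i)
              }
            ; antisym = λ x≤y y≤x → T.antisym
                (coordinate⇒⊑ (Lex-antisym {R = coordinate i Vector.∷ coordinate} x≤y y≤x ∘ suc))
                (coordinate⇒⊑ (Lex-antisym {R = coordinate i Vector.∷ coordinate} y≤x x≤y ∘ suc))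
            }
          ; total = Lex-total em
              (prepended {P = λ R → Total R} (λ i x y → C.total i (g x i) (g y i)) i)
          }
        -- The leading comparisons of the `n` orders are together all the coordinates.
        ; intersection = λ x y → mk⇔ ⊑⇒lexicographic λ x≤y → coordinate⇒⊑ λ i → proj₁ (x≤y i)
        }
        where
        ⊑⇒lexicographic : ∀ {x y} → x T.≤ y → ∀ i → lexicographic i x y
        ⊑⇒lexicographic {x} {y} x⊑y i = Lex-intro {R = coordinate i Vector.∷ coordinate}
          (prepended {P = λ R → R x y} (⊑⇒coordinate x⊑y) i)

      lexicographicRealizer-scattered : ∀ i →
        Scattered (TotalOrder.poset (Realizer.linearOrder lexicographicRealizer i))
      lexicographicRealizer-scattered i =
        scattered⁺ (TotalOrder.poset (Realizer.linearOrder lexicographicRealizer i))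
          (Lex-scattered em
            (prepended {P = λ R → Transitive R} coordinate-trans i)
            (prepended {P = λ R → ¬ Contains-ℚ R} coordinate-scattered i))

    sublattice⇒intersection : ∀ n → SublatticeOfProductOfScatteredChains T n →
      IntersectionOfScatteredLinearOrders T n
    sublattice⇒intersection n (C , C-scattered , g , g-mono) =
      lexicographicRealizer C C-scattered g g-mono ,
      lexicographicRealizer-scattered C C-scattered g g-mono

    -- Positivity of `n` provides the order `zero`, to which a copy of ℚ in `T` transfers;
    -- strictness survives because a reversed pair would be equal by antisymmetry.
    intersection⇒dimension : ∀ n → .{{NonZero n}} → IntersectionOfScatteredLinearOrders T n →
      Dimension≤×Scattered T n
    intersection⇒dimension n@(suc _) (R , R-scattered) =
      least em (Realizer T.poset) n R ,
      scattered⁺ T.poset λ (g , embedding) → let open IsEmbedding embedding in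
        scattered⁻ (TotalOrder.poset (R.linearOrder zero)) (R-scattered zero) (g , strict⇒embedding
          (λ p≤q → ⊑⇒order (mono p≤q))
          (λ p<q gq≤gp → ℚ.<-irrefl refl (ℚ.<-≤-trans p<q (cancel (T.reflexive
            (O.antisym gq≤gp (⊑⇒order (mono (ℚ.<⇒≤ p<q)))))))))
      where
      module R = Realizer R
      module O = IsTotalOrder (R.isTotalOrder zero)
      ⊑⇒order : ∀ {x y} → x T.≤ y → R.order zero x y
      ⊑⇒order {x} {y} x⊑y = Equivalence.to (R.intersection x y) x⊑y zero

theorem4 : ∀ {c ℓ₁ ℓ₂} → Classical →
    (T : DistributiveLattice c ℓ₁ ℓ₂) (n : ℕ) → .{{_ : NonZero n}} →
    (IntersectionOfScatteredLinearOrders T n ⇔ SublatticeOfProductOfScatteredChains T n) ×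
    (SublatticeOfProductOfScatteredChains T n ⇔ Dimension≤×Scattered T n)
theorem4 classical T n =
  mk⇔ (iii⇒ii ∘ i⇒iii) ii⇒i , mk⇔ (i⇒iii ∘ ii⇒i) iii⇒ii
  where
  open Classical classical using () renaming (excludedMiddle to em)
  i⇒iii  = intersection⇒dimension (λ {ℓ} → em {ℓ}) T n
  ii⇒i   = sublattice⇒intersection (λ {ℓ} → em {ℓ}) T n
  iii⇒ii = dimension⇒sublattice (λ {ℓ} → em {ℓ}) T n
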